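{- For all integers $n\geq 0$ and $i\geq 1$, \begin{align*} \bar a_{2i}(4n+3)&\equiv 0 \pmod 4, & \bar a_{2i}(8n+6)&\equiv 0 \pmod 4,\\ \bar a_{2i}(8n+5)&\equiv 0 \pmod 4, & \bar a_{2i}(8n+7)&\equiv 0 \pmod 8. \end{align*}
   Context: For an integer $k\geq 1$ let $f_k:=\prod_{n\geq 1}(1-q^{kn})$. For an integer $c\geq1$, the generalized overcubic partition function $\bar a_c(n)$ is defined by the generating function $\sum_{n\geq 0}\bar a_c(n)q^n=\dfrac{f_4^{c-1}}{f_1^2f_2^{2c-3}}$. -}

module Defs where

open import Algebra.Bundles using (CommutativeRing)
open import Data.Bool.Base using (if_then_else_)
open import Data.Fin.Base using (Fin; zero; suc; toℕ)
open import Data.Integer.Base using (ℤ; +_; -[1+_]; 0ℤ; 1ℤ; _+_; _-_; _*_; -_)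
open import Data.Integer.Properties
open import Data.Nat.Base as ℕ using (ℕ; zero; suc; _∸_; _≡ᵇ_; _≤_; _<_; z≤n; s≤s)
import Data.Nat.Properties as ℕ
open import Data.Vec.Base using (Vec; []; _∷_; head; lookup)
open import Relation.Binary.PropositionalEquality
open import Algebra.Properties.Semiring.Sum
  (CommutativeRing.semiring +-*-commutativeRing)
  using (sum-syntax; sum⁺-syntax; sum-cong-≗; sum-replicate-zero)

-- A series is given by its coefficients: a stands for ∑ₙ (a n) qⁿ in ℤ[[q]].

Series : Set
Series = ℕ → ℤ

infix  9 q^_ _⁻¹
infixl 6 _⊖_
infixl 7 _⊛_
infixr 8 _^_ _^ᶻ_

q^_ : ℕ → Series
(q^ e) n = if n ≡ᵇ e then 1ℤ else 0ℤ

𝟙 : Series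
𝟙 = q^ 0

_⊖_ : Series → Series → Series
(a ⊖ b) n = a n - b n

_⊛_ : Series → Series → Series
(a ⊛ b) n = ∑[ j ≤ n ] (a (toℕ j) * b (n ∸ toℕ j))

_^_ : Series → ℕ → Series
a ^ zero  = 𝟙
a ^ suc e = a ⊛ (a ^ e)

-- The coefficients g n , … , g 0 (in this order) of the inverse g of a series
-- a with constant term 1; for other a the result has no meaning (see ⊛-inverseʳ).

inverseCoeffs : Series → (n : ℕ) → Vec ℤ (suc n)
inverseCoeffs a zero    = 1ℤ ∷ []
inverseCoeffs a (suc n) =
  - (∑[ j ≤ n ] (a (suc (toℕ j)) * lookup (inverseCoeffs a n) j))
  ∷ inverseCoeffs a n

_⁻¹ : Series → Series
(a ⁻¹) n = head (inverseCoeffs a n)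

_^ᶻ_ : Series → ℤ → Series
a ^ᶻ (+ e)    = a ^ e
a ^ᶻ -[1+ e ] = (a ⁻¹) ^ suc e

∏≤ : ℕ → (ℕ → Series) → Series
∏≤ zero    F = 𝟙
∏≤ (suc N) F = F (suc N) ⊛ ∏≤ N F

-- The infinite product ∏_{n≥1} F n of factors with F n ≡ 1 (mod qⁿ): the
-- factors with n > m do not affect the coefficient of qᵐ (see f-stable; this
-- covers f k only for k ≥ 1).

∏∞ : (ℕ → Series) → Series
∏∞ F m = ∏≤ m F m

f : ℕ → Series
f k = ∏∞ (λ n → 𝟙 ⊖ q^ (k ℕ.* n))

-- Meant for c ≥ 1. The exponents are integers since 2c - 3 = -1 when c = 1.

ā : ℕ → Series
ā c = (f 4 ^ᶻ (+ c - + 1))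
    ⊛ (f 1 ^ 2 ⊛ f 2 ^ᶻ (+ 2 * + c - + 3)) ⁻¹

lookup-inverseCoeffs : ∀ a n (j : Fin (suc n)) →
  lookup (inverseCoeffs a n) j ≡ (a ⁻¹) (n ∸ toℕ j)
lookup-inverseCoeffs a zero    zero    = refl
lookup-inverseCoeffs a (suc n) zero    = refl
lookup-inverseCoeffs a (suc n) (suc j) = lookup-inverseCoeffs a n j

⊛-inverseʳ : ∀ a → a 0 ≡ 1ℤ → a ⊛ a ⁻¹ ≗ 𝟙
⊛-inverseʳ a a₀≡1 zero rewrite a₀≡1 = refl
⊛-inverseʳ a a₀≡1 (suc n) = begin
  a 0 * - S + (∑[ j ≤ n ] (a (suc (toℕ j)) * (a ⁻¹) (n ∸ toℕ j)))
    ≡⟨ cong₂ _+_ (cong (_* - S) a₀≡1)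
         (sum-cong-≗ λ j → cong (a (suc (toℕ j)) *_)
           (sym (lookup-inverseCoeffs a n j))) ⟩
  1ℤ * - S + S ≡⟨ cong (_+ S) (*-identityˡ (- S)) ⟩
  - S + S      ≡⟨ +-inverseˡ S ⟩
  0ℤ           ∎
  where
  open ≡-Reasoning
  S = ∑[ j ≤ n ] (a (suc (toℕ j)) * lookup (inverseCoeffs a n) j)

q^-below : ∀ {m e} → m < e → (q^ e) m ≡ 0ℤ
q^-below {zero}  {suc e} _         = refl
q^-below {suc m} {suc e} (s≤s m<e) = q^-below m<e

⊛-below : ∀ {m e} (a : Series) → m < e → ((𝟙 ⊖ q^ e) ⊛ a) m ≡ a m
⊛-below {m} {e} a m<e = begin
  ((𝟙 ⊖ q^ e) ⊛ a) m
    ≡⟨ cong₂ _+_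
         (cong (λ x → (1ℤ - x) * a m) (q^-below (ℕ.≤-<-trans z≤n m<e)))
         (sum-cong-≗ λ j → cong (λ x → (0ℤ - x) * a (m ∸ suc (toℕ j)))
           (q^-below (ℕ.≤-<-trans (toℕ<n j) m<e))) ⟩
  1ℤ * a m + (∑[ j < m ] 0ℤ)
    ≡⟨ cong₂ _+_ (*-identityˡ (a m)) (sum-replicate-zero m) ⟩
  a m + 0ℤ ≡⟨ +-identityʳ (a m) ⟩
  a m ∎
  where
  open ≡-Reasoning
  open import Data.Fin.Properties using (toℕ<n)

f-stable : ∀ k .{{_ : ℕ.NonZero k}} {m N} → m ≤ N →
  ∏≤ N (λ n → 𝟙 ⊖ q^ (k ℕ.* n)) m ≡ f k m
f-stable k m≤N = go (ℕ.≤⇒≤′ m≤N)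
  where
  go : ∀ {m N} → m ℕ.≤′ N → ∏≤ N (λ n → 𝟙 ⊖ q^ (k ℕ.* n)) m ≡ f k m
  go (ℕ.≤′-reflexive refl) = refl
  go {m} {suc N} (ℕ.≤′-step m≤′N) = trans
    (⊛-below (∏≤ N _)
      (ℕ.<-≤-trans (s≤s (ℕ.≤′⇒≤ m≤′N)) (ℕ.m≤n*m (suc N) k)))
    (go m≤′N)

f-constant : ∀ k → f k 0 ≡ 1ℤ
f-constant k = refl

{-# OPTIONS --safe #-}
module Submission where

-- With φ(-q) = ∑ₙ (-1)ⁿ q^(n²), Gauss's identity f₁² = f₂ φ(-q) gives
--   ā_c = 1 / (φ(-q) φ(-q²)^(c-1)).
-- Modulo 8 every series in sight has the form 1 + 2s + 4t, where s lives on
-- exponents that are 0, 1, 2 or 4 mod 8 (the residues of x² and 2x²) and t on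
-- exponents that are not 7 mod 8. As no sum of two of these four residues
-- is 7 mod 8, such series are closed under products and inverses.
--
-- Gauss's identity comes from a finite version in the style of Shanks: with
-- Uₙ = ∏_{k≤n} (1 - q^k) and Vₙ = ∏_{k≤n} (1 + q^k),
--   Vₙ ∑_{|k|≤n} (-1)^k q^(k²) = Uₙ + 2 Dₙ(q^(n+1)),
--   Dₙ(x) = ∑_{1≤s≤n} (-1)^s V_{s-1} (Uₙ / U_s) x^s.

open import Algebra.Bundles using (CommutativeRing)
open import Data.Fin.Base using (Fin; zero; suc; toℕ; fromℕ<)
open import Data.Fin.Properties as Fin using (toℕ≤pred[n])
open import Data.Integer.Base as ℤ using (ℤ; +_; -[1+_]; 0ℤ; 1ℤ; +0)
open import Data.Integer.Divisibility.Signed using (_∣_; divides)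
import Data.Integer.Properties as ℤ
import Data.Integer.Tactic.RingSolver as ℤSolver
open import Data.List.Base using (List; []; _∷_)
open import Data.List.Membership.Propositional using (_∈_)
open import Data.List.Relation.Unary.All as All using (All)
open import Data.Maybe.Base using (map)
open import Data.Nat.Base as ℕ using (ℕ; zero; suc)
import Data.Nat.Divisibility as ℕ
open import Data.Nat.DivMod using
  (_%_; %-distribˡ-+; %-distribˡ-*; m%n<n; [m+kn]%n≡m%n; m∣n⇒o%n%m≡o%m; m%n%n≡m%n)
import Data.Nat.Properties as ℕ
import Data.Nat.Tactic.RingSolver as ℕSolver
open import Data.Product.Base using (∃-syntax; _,_)
import Data.Sign.Base as Sign
open import Data.Sum.Base as Sum using (_⊎_; inj₁; inj₂)
open import Function.Base using (_∘_; case_of_)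
open import Level using (0ℓ)
open import Relation.Binary.Consequences using (dec⇒weaklyDec)
open import Relation.Binary.PropositionalEquality as ≡ using (_≡_; _≢_; _≗_)
open import Relation.Nullary.Decidable using (from-yes; ¬?)
open import Relation.Nullary.Negation using (contradiction; ¬_)

open import Algebra.Properties.Semiring.Sum
  (CommutativeRing.semiring ℤ.+-*-commutativeRing)
  using (sum; sum-cong-≗; sum-replicate-zero)
open import Data.List.Membership.DecPropositional ℕ._≟_ using (_∈?_)

-- The map from ℤ to a commutative ring, and a polynomial solver with integer coefficients.

module IntegerCoefficients {c ℓ} (R : CommutativeRing c ℓ) where
  open CommutativeRing R
  open import Algebra.Properties.Ring ring
  open import Algebra.Properties.AbelianGroup +-abelianGroup using (⁻¹-∙-comm)
  open import Algebra.Properties.Semiring.Mult.TCOptimised semiring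
  open import Algebra.Solver.Ring.AlmostCommutativeRing
    using (fromCommutativeRing; _-Raw-AlmostCommutative⟶_)
  open import Relation.Binary.Reasoning.Setoid setoid

  -- With the optimised multiples, `1 × 1#` computes to `1#`, so `con 0ℤ` and `con 1ℤ` denote
  -- exactly the `0#` and `1#` of the goals.
  fromℤ : ℤ → Carrier
  fromℤ (+ n)    = n × 1#
  fromℤ -[1+ n ] = - (suc n × 1#)

  fromℤ-neg : ∀ i → fromℤ (ℤ.- i) ≈ - fromℤ i
  fromℤ-neg +0         = sym -0#≈0#
  fromℤ-neg (+ suc n)  = refl
  fromℤ-neg -[1+ n ]   = sym (-‿involutive (suc n × 1#))

  fromℤ-⊖ : ∀ m n → fromℤ (m ℤ.⊖ n) ≈ m × 1# - n × 1#
  fromℤ-⊖ m       zero    = begin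
    m × 1#        ≈⟨ +-identityʳ _ ⟨
    m × 1# + 0#   ≈⟨ +-congˡ -0#≈0# ⟨
    m × 1# - 0#   ∎
  fromℤ-⊖ zero    (suc n) = sym (+-identityˡ _)
  fromℤ-⊖ (suc m) (suc n) = begin
    fromℤ (suc m ℤ.⊖ suc n)          ≡⟨ ≡.cong fromℤ (ℤ.[1+m]⊖[1+n]≡m⊖n m n) ⟩
    fromℤ (m ℤ.⊖ n)                  ≈⟨ fromℤ-⊖ m n ⟩
    a - b                            ≈⟨ +-congʳ (+-identityˡ a) ⟨
    0# + a - b                       ≈⟨ +-congʳ (+-congʳ (-‿inverseʳ 1#)) ⟨
    1# - 1# + a - b                  ≈⟨ +-congʳ (+-assoc _ _ _) ⟩
    1# + (- 1# + a) - b              ≈⟨ +-congʳ (+-congˡ (+-comm _ _)) ⟩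
    1# + (a - 1#) - b                ≈⟨ +-congʳ (+-assoc _ _ _) ⟨
    1# + a - 1# - b                  ≈⟨ +-assoc _ _ _ ⟩
    1# + a + (- 1# - b)              ≈⟨ +-congˡ (⁻¹-∙-comm 1# b) ⟩
    1# + a - (1# + b)                ≈⟨ +-cong (×-homo-+ 1# 1 m) (-‿cong (×-homo-+ 1# 1 n)) ⟨
    suc m × 1# - suc n × 1#          ∎
    where a = m × 1#; b = n × 1#

  fromℤ-+ : ∀ i j → fromℤ (i ℤ.+ j) ≈ fromℤ i + fromℤ j
  fromℤ-+ (+ m)    (+ n)    = ×-homo-+ 1# m n
  fromℤ-+ (+ m)    -[1+ n ] = fromℤ-⊖ m (suc n)
  fromℤ-+ -[1+ m ] (+ n)    = trans (fromℤ-⊖ n (suc m)) (+-comm _ _)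
  fromℤ-+ -[1+ m ] -[1+ n ] = begin
    - (suc (suc (m ℕ.+ n)) × 1#)     ≡⟨ ≡.cong (λ k → - (suc k × 1#)) (ℕ.+-suc m n) ⟨
    - ((suc m ℕ.+ suc n) × 1#)       ≈⟨ -‿cong (×-homo-+ 1# (suc m) (suc n)) ⟩
    - (suc m × 1# + suc n × 1#)      ≈⟨ ⁻¹-∙-comm _ _ ⟨
    - (suc m × 1#) - suc n × 1#      ∎

  fromℤ-* : ∀ i j → fromℤ (i ℤ.* j) ≈ fromℤ i * fromℤ j
  fromℤ-* (+ m)    (+ n)    = trans
    (reflexive (≡.cong fromℤ (ℤ.+◃n≡+n (m ℕ.* n)))) (×1-homo-* m n)
  fromℤ-* (+ m)    -[1+ n ] = begin
    fromℤ (Sign.- ℤ.◃ (m ℕ.* suc n))  ≡⟨ ≡.cong fromℤ (ℤ.-◃n≡-n (m ℕ.* suc n)) ⟩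
    fromℤ (ℤ.- (+ (m ℕ.* suc n)))     ≈⟨ fromℤ-neg (+ (m ℕ.* suc n)) ⟩
    - ((m ℕ.* suc n) × 1#)            ≈⟨ -‿cong (×1-homo-* m (suc n)) ⟩
    - (m × 1# * (suc n × 1#))         ≈⟨ -‿distribʳ-* _ _ ⟩
    m × 1# * - (suc n × 1#)           ∎
  fromℤ-* -[1+ m ] (+ n)    = begin
    fromℤ (Sign.- ℤ.◃ (suc m ℕ.* n))  ≡⟨ ≡.cong fromℤ (ℤ.-◃n≡-n (suc m ℕ.* n)) ⟩
    fromℤ (ℤ.- (+ (suc m ℕ.* n)))     ≈⟨ fromℤ-neg (+ (suc m ℕ.* n)) ⟩
    - ((suc m ℕ.* n) × 1#)            ≈⟨ -‿cong (×1-homo-* (suc m) n) ⟩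
    - (suc m × 1# * (n × 1#))         ≈⟨ -‿distribˡ-* _ _ ⟩
    - (suc m × 1#) * (n × 1#)         ∎
  fromℤ-* -[1+ m ] -[1+ n ] = begin
    (suc m ℕ.* suc n) × 1#            ≈⟨ ×1-homo-* (suc m) (suc n) ⟩
    suc m × 1# * (suc n × 1#)         ≈⟨ -‿involutive _ ⟨
    - - (suc m × 1# * (suc n × 1#))   ≈⟨ -‿cong (-‿distribˡ-* _ _) ⟩
    - (- (suc m × 1#) * (suc n × 1#)) ≈⟨ -‿distribʳ-* _ _ ⟩
    - (suc m × 1#) * - (suc n × 1#)   ∎

  -- Equality of coefficients is decided in ℤ, so the solver can cancel terms even when equality in
  -- `R` is undecidable.
  morphism : CommutativeRing.rawRing ℤ.+-*-commutativeRing
             -Raw-AlmostCommutative⟶ fromCommutativeRing R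
  morphism = record
    { ⟦_⟧    = fromℤ
    ; +-homo = fromℤ-+
    ; *-homo = fromℤ-*
    ; -‿homo = fromℤ-neg
    ; 0-homo = refl
    ; 1-homo = refl
    }

  open import Algebra.Solver.Ring
    (CommutativeRing.rawRing ℤ.+-*-commutativeRing) (fromCommutativeRing R) morphism
    (λ i j → map (reflexive ∘ ≡.cong fromℤ) (dec⇒weaklyDec ℤ._≟_ i j))
    public using (Polynomial; solve; _:=_; _:+_; _:*_; _:-_; :-_; con)

open import Data.Product.Base using (_×_)

-- Gauss's identity and the reciprocal of the overcubic quotient, in any commutative ring.

module EtaQuotients {c ℓ} (R : CommutativeRing c ℓ) where
  open CommutativeRing R
  open IntegerCoefficients R
  open import Algebra.Properties.Ring ring using (-‿distribʳ-*)
  open import Algebra.Properties.CommutativeSemiring.Exp commutativeSemiring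
  open import Relation.Binary.Reasoning.Setoid setoid

  private
    𝟏 : ∀ {n} → Polynomial n
    𝟏 = con 1ℤ

  -- The k-th summand of `S`, written `(- (q ^ k)) ^ k`, is (-1)^k q^(k²): one power yields both the
  -- sign and the square exponent.
  U V S : Carrier → ℕ → Carrier
  U q zero    = 1#
  U q (suc n) = (1# - q ^ suc n) * U q n
  V q zero    = 1#
  V q (suc n) = (1# + q ^ suc n) * V q n
  S q zero    = 0#
  S q (suc n) = S q n + (- (q ^ suc n)) ^ suc n

  -- The sum of (-1)^k q^(k²) over |k| ≤ n, since k and -k give equal terms. The shape 1 + 2s is the
  -- one that `expansion-1+2s` accepts.
  θ : Carrier → ℕ → Carrier
  θ q n = 1# + (S q n + S q n)

  -- The recursion in n avoids the quotients Uₙ / U_s.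
  D : Carrier → ℕ → Carrier → Carrier
  D q zero    x = 0#
  D q (suc n) x = (1# - q ^ suc n) * D q n x + V q n * (- x) ^ suc n

  -[x*y]^n : ∀ x y n → (- (x * y)) ^ n ≈ x ^ n * (- y) ^ n
  -[x*y]^n x y n = trans (^-congˡ n (-‿distribʳ-* x y)) (^-distrib-* x (- y) n)

  -- This q-difference equation moves the argument of `D` from x to qx. In the induction step the
  -- terms with Vₙ agree because both sides contribute (1 - x q^(n+1)) Vₙ (-x)^(n+1).
  D-functional : ∀ q n x →
    (1# - x) * D q n (q * x) ≈
    (1# + x) * D q n x + x * U q n + V q n * (- x) ^ suc n
  D-functional q zero x =
    solve 1 (λ x → (𝟏 :- x) :* con 0ℤ
      := (𝟏 :+ x) :* con 0ℤ :+ x :* 𝟏 :+ 𝟏 :* ((:- x) :* 𝟏)) refl x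
  D-functional q (suc n) x = begin
    (1# - x) * ((1# - Q) * d′ + v * (- (q * x)) ^ suc n)
      ≈⟨ *-congˡ (+-congˡ (*-congˡ (-[x*y]^n q x (suc n)))) ⟩
    (1# - x) * ((1# - Q) * d′ + v * (Q * e))
      ≈⟨ solve 5 (λ x Q d′ v e →
           (𝟏 :- x) :* ((𝟏 :- Q) :* d′ :+ v :* (Q :* e))
           := (𝟏 :- Q) :* ((𝟏 :- x) :* d′) :+ (𝟏 :- x) :* (v :* (Q :* e)))
           refl x Q d′ v e ⟩
    (1# - Q) * ((1# - x) * d′) + (1# - x) * (v * (Q * e))
      ≈⟨ +-congʳ (*-congˡ (D-functional q n x)) ⟩
    (1# - Q) * ((1# + x) * d + x * u + v * e) + (1# - x) * (v * (Q * e))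
      ≈⟨ solve 6 (λ x Q d u v e →
           (𝟏 :- Q) :* ((𝟏 :+ x) :* d :+ x :* u :+ v :* e) :+ (𝟏 :- x) :* (v :* (Q :* e))
           := (𝟏 :+ x) :* ((𝟏 :- Q) :* d :+ v :* e) :+ x :* ((𝟏 :- Q) :* u)
              :+ ((𝟏 :+ Q) :* v) :* ((:- x) :* e))
           refl x Q d u v e ⟩
    (1# + x) * ((1# - Q) * d + v * e) + x * ((1# - Q) * u) + ((1# + Q) * v) * (- x * e) ∎
    where
    Q = q ^ suc n
    d = D q n x
    d′ = D q n (q * x)
    u = U q n
    v = V q n
    e = (- x) ^ suc n

  -- Induction on n: multiply by 1 + Q with Q = q^(n+1) and write (1 + Q) Uₙ as (1 - Q) Uₙ + 2 Q Uₙ.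
  -- The surplus 2 Q Uₙ and the new theta terms complete 2 Dₙ(Q) to 2 Dₙ₊₁(qQ).
  finite-Gauss : ∀ q n →
    V q n * θ q n ≈ U q n + (D q n (q ^ suc n) + D q n (q ^ suc n))
  finite-Gauss q zero =
    solve 0 (𝟏 :* (𝟏 :+ (con 0ℤ :+ con 0ℤ)) := 𝟏 :+ (con 0ℤ :+ con 0ℤ)) refl
  finite-Gauss q (suc n) = begin
    (1# + Q) * v * (1# + (s + e + (s + e)))
      ≈⟨ solve 4 (λ Q v s e →
           (𝟏 :+ Q) :* v :* (𝟏 :+ (s :+ e :+ (s :+ e)))
           := (𝟏 :+ Q) :* (v :* (𝟏 :+ (s :+ s))) :+ (𝟏 :+ Q) :* (v :* (e :+ e)))
           refl Q v s e ⟩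
    (1# + Q) * (v * θ q n) + (1# + Q) * (v * (e + e))
      ≈⟨ +-congʳ (*-congˡ (finite-Gauss q n)) ⟩
    (1# + Q) * (u + (d + d)) + (1# + Q) * (v * (e + e))
      ≈⟨ solve 5 (λ Q u v d e →
           (𝟏 :+ Q) :* (u :+ (d :+ d)) :+ (𝟏 :+ Q) :* (v :* (e :+ e))
           := (𝟏 :- Q) :* u
              :+ (((𝟏 :+ Q) :* d :+ Q :* u :+ v :* e :+ v :* (Q :* e))
              :+ ((𝟏 :+ Q) :* d :+ Q :* u :+ v :* e :+ v :* (Q :* e))))
           refl Q u v d e ⟩
    (1# - Q) * u + (_ + _)
      ≈⟨ +-congˡ (+-cong step step) ⟨
    (1# - Q) * u + (D q (suc n) (q * Q) + D q (suc n) (q * Q)) ∎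
    where
    Q = q ^ suc n
    d = D q n Q
    u = U q n
    v = V q n
    s = S q n
    e = (- Q) ^ suc n
    -- At x = Q the factor 1 - x of `D-functional` coincides with the factor 1 - Q in the recursion
    -- for `D`; hence the choice of q^(n+1) as argument.
    step : D q (suc n) (q * Q) ≈ (1# + Q) * d + Q * u + v * e + v * (Q * e)
    step = +-cong (D-functional q n Q) (*-congˡ (-[x*y]^n q Q (suc n)))

  -- Each summand of `D` carries a positive power of x, so the error term of the finite identity
  -- disappears once q^(n+1) = 0.
  D-vanishes : ∀ q n {x} → x ≈ 0# → D q n x ≈ 0#
  D-vanishes q zero        x≈0 = refl
  D-vanishes q (suc n) {x} x≈0 = begin
    (1# - q ^ suc n) * D q n x + V q n * (- x * (- x) ^ n)
      ≈⟨ +-cong (*-congˡ (D-vanishes q n x≈0)) (*-congˡ (*-congʳ (-‿cong x≈0))) ⟩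
    (1# - q ^ suc n) * 0# + V q n * (- 0# * (- x) ^ n)
      ≈⟨ solve 3 (λ a b c → a :* con 0ℤ :+ b :* ((:- con 0ℤ) :* c) := con 0ℤ)
           refl _ _ _ ⟩
    0# ∎

  -- Difference of squares in each factor. A separate `r` allows the series q^(2k), which equals the
  -- square of q^k only up to `≈`.
  U*V : ∀ q r n → r ≈ q * q → U q n * V q n ≈ U r n
  U*V q r zero    r≈q² = *-identityˡ 1#
  U*V q r (suc n) r≈q² = begin
    (1# - Q) * U q n * ((1# + Q) * V q n)
      ≈⟨ solve 3 (λ Q u v → (𝟏 :- Q) :* u :* ((𝟏 :+ Q) :* v)
           := (𝟏 :- Q :* Q) :* (u :* v)) refl Q (U q n) (V q n) ⟩
    (1# - Q * Q) * (U q n * V q n)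
      ≈⟨ *-cong (+-congˡ (-‿cong
           (trans (^-congˡ (suc n) r≈q²) (^-distrib-* q q (suc n)))))
           (sym (U*V q r n r≈q²)) ⟨
    (1# - r ^ suc n) * U r n ∎
    where Q = q ^ suc n

  -- Multiplying the finite identity by Uₙ(q) turns Vₙ(q) into Uₙ(q²), which avoids a division by
  -- Vₙ.
  Gauss : ∀ q r n → q ^ suc n ≈ 0# → r ≈ q * q → U q n * U q n ≈ U r n * θ q n
  Gauss q r n qⁿ⁺¹≈0 r≈q² = begin
    u * u                      ≈⟨ *-congˡ (+-identityʳ u) ⟨
    u * (u + 0#)               ≈⟨ *-congˡ (+-congˡ (+-identityʳ 0#)) ⟨
    u * (u + (0# + 0#))        ≈⟨ *-congˡ (+-congˡ (+-cong D≈0 D≈0)) ⟨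
    u * (u + (d + d))          ≈⟨ *-congˡ (finite-Gauss q n) ⟨
    u * (V q n * θ q n)        ≈⟨ *-assoc _ _ _ ⟨
    u * V q n * θ q n          ≈⟨ *-congʳ (U*V q r n r≈q²) ⟩
    U r n * θ q n              ∎
    where
    u = U q n
    d = D q n (q ^ suc n)
    D≈0 = D-vanishes q n qⁿ⁺¹≈0

  -- Here k = c - 2, so the exponents are c - 1 and 2c - 3, and `h` inverts the denominator. Two
  -- uses of Gauss's identity give f₁² f₂^(2k+1) = θ₁ f₂^(2k+2) = θ₁ (f₄ θ₂)^(k+1).
  eta-quotient-reciprocal : ∀ {f₁ f₂ f₄ g h θ₁ θ₂} k →
    f₁ * f₁ ≈ f₂ * θ₁ → f₂ * f₂ ≈ f₄ * θ₂ → f₄ * g ≈ 1# →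
    (f₁ ^ 2 * f₂ ^ suc (k ℕ.+ k)) * h ≈ 1# →
    (θ₁ * θ₂ ^ suc k) * (f₄ ^ suc k * h) ≈ 1#
  eta-quotient-reciprocal {f₁} {f₂} {f₄} {g} {h} {θ₁} {θ₂} k f₁² f₂² f₄g≈1 yh≈1 = begin
    θ₁ * θ₂ ^ suc k * (f₄ ^ suc k * h)
      ≈⟨ *-identityˡ _ ⟨
    1# * (θ₁ * θ₂ ^ suc k * (f₄ ^ suc k * h))
      ≈⟨ *-congʳ f₄ᵏgᵏ≈1 ⟨
    f₄ ^ suc k * g ^ suc k * (θ₁ * θ₂ ^ suc k * (f₄ ^ suc k * h))
      ≈⟨ solve 5 (λ f g t₁ t₂ h →
           f :* g :* (t₁ :* t₂ :* (f :* h)) := f :* g :* (t₁ :* (f :* t₂) :* h))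
           refl (f₄ ^ suc k) (g ^ suc k) θ₁ (θ₂ ^ suc k) h ⟩
    f₄ ^ suc k * g ^ suc k * (θ₁ * (f₄ ^ suc k * θ₂ ^ suc k) * h)
      ≈⟨ *-cong f₄ᵏgᵏ≈1 (*-congʳ (*-congˡ (sym f₂²ᵏ))) ⟩
    1# * (θ₁ * (f₂ ^ suc k * f₂ ^ suc k) * h)
      ≈⟨ solve 4 (λ t₁ f p h →
           𝟏 :* (t₁ :* (f :* p :* (f :* p)) :* h) := f :* t₁ :* (f :* (p :* p)) :* h)
           refl θ₁ f₂ (f₂ ^ k) h ⟩
    f₂ * θ₁ * (f₂ * (f₂ ^ k * f₂ ^ k)) * h
      ≈⟨ *-congʳ (*-cong (trans (*-congˡ (*-identityʳ f₁)) f₁²)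
           (*-congˡ (^-homo-* f₂ k k))) ⟨
    f₁ ^ 2 * f₂ ^ suc (k ℕ.+ k) * h
      ≈⟨ yh≈1 ⟩
    1# ∎
    where
    1^n≈1 : ∀ n → 1# ^ n ≈ 1#
    1^n≈1 zero    = refl
    1^n≈1 (suc n) = trans (*-identityˡ _) (1^n≈1 n)
    f₄ᵏgᵏ≈1 : f₄ ^ suc k * g ^ suc k ≈ 1#
    f₄ᵏgᵏ≈1 = trans (sym (^-distrib-* f₄ g (suc k)))
      (trans (^-congˡ (suc k) f₄g≈1) (1^n≈1 (suc k)))
    f₂²ᵏ : f₂ ^ suc k * f₂ ^ suc k ≈ f₄ ^ suc k * θ₂ ^ suc k
    f₂²ᵏ = trans (sym (^-distrib-* f₂ f₂ (suc k)))
      (trans (^-congˡ (suc k) f₂²) (^-distrib-* f₄ θ₂ (suc k)))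

-- Expansions 1 + 2s + 4t + 8u and their closure properties.

module DyadicExpansions {c ℓ} (R : CommutativeRing c ℓ) where
  open CommutativeRing R
  open IntegerCoefficients R
  open import Algebra.Properties.Semiring.Exp semiring
  open import Relation.Binary.Reasoning.Setoid setoid

  -- `P₁` and `P₂` stand for the support conditions on s and t; `P₁-*` lets a product of two such s
  -- count as a t.
  module Closure {p} (P₁ P₂ : Carrier → Set p)
    (P₁-0 : P₁ 0#) (P₁-+ : ∀ {x y} → P₁ x → P₁ y → P₁ (x + y))
    (P₁-neg : ∀ {x} → P₁ x → P₁ (- x))
    (P₂-0 : P₂ 0#) (P₂-+ : ∀ {x y} → P₂ x → P₂ y → P₂ (x + y))
    (P₂-neg : ∀ {x} → P₂ x → P₂ (- x))
    (P₁-* : ∀ {x y} → P₁ x → P₁ y → P₂ (x * y))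
    where

    double : Carrier → Carrier
    double x = x + x

    private
      𝟏 : ∀ {n} → Polynomial n
      𝟏 = con 1ℤ
      dbl : ∀ {n} → Polynomial n → Polynomial n
      dbl p = p :+ p

    -- A congruence modulo 8 written as an equation: `u` is arbitrary.
    Expansion : Carrier → Set _
    Expansion x = ∃[ s ] ∃[ t ] ∃[ u ]
      (P₁ s × P₂ t × x ≈ 1# + double (s + double (t + double u)))

    expansion-1 : Expansion 1#
    expansion-1 = 0# , 0# , 0# , P₁-0 , P₂-0 ,
      solve 0 (𝟏 := 𝟏 :+ dbl (con 0ℤ :+ dbl (con 0ℤ :+ dbl (con 0ℤ)))) refl

    expansion-1+2s : ∀ {s} → P₁ s → Expansion (1# + (s + s))
    expansion-1+2s {s} Ps = s , 0# , 0# , Ps , P₂-0 ,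
      solve 1 (λ s → 𝟏 :+ dbl s := 𝟏 :+ dbl (s :+ dbl (con 0ℤ :+ dbl (con 0ℤ)))) refl s

    -- The only cross term without a factor 8 is 2s · 2s′ = 4 s s′, which joins t + t′.
    expansion-* : ∀ {x y} → Expansion x → Expansion y → Expansion (x * y)
    expansion-* (s , t , u , Ps , Pt , x≈) (s′ , t′ , u′ , Ps′ , Pt′ , y≈) =
      s + s′ , t + t′ + s * s′ , _ ,
      P₁-+ Ps Ps′ , P₂-+ (P₂-+ Pt Pt′) (P₁-* Ps Ps′) ,
      trans (*-cong x≈ y≈)
        (solve 6 (λ s t u s′ t′ u′ →
          (𝟏 :+ dbl (s :+ dbl (t :+ dbl u))) :* (𝟏 :+ dbl (s′ :+ dbl (t′ :+ dbl u′)))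
          := 𝟏 :+ dbl (s :+ s′ :+ dbl (t :+ t′ :+ s :* s′ :+ dbl
               (u :+ u′ :+ s :* t′ :+ t :* s′
                :+ dbl (s :* u′ :+ t :* t′ :+ u :* s′
                :+ dbl (t :* u′ :+ u :* t′ :+ dbl (u :* u′)))))))
          refl s t u s′ t′ u′)

    expansion-^ : ∀ {x} → Expansion x → ∀ n → Expansion (x ^ n)
    expansion-^ Ex zero    = expansion-1
    expansion-^ Ex (suc n) = expansion-* Ex (expansion-^ Ex n)

    -- The element z = 1 - 2s + 4(s² - t) inverts x modulo 8: x z = 1 + 8w with the `w` below. Hence
    -- y = (x y) z - 8 w y = z - 8 w y.
    expansion-inverse : ∀ {x y} → Expansion x → x * y ≈ 1# → Expansion y
    expansion-inverse {x} {y} (s , t , u , Ps , Pt , x≈) xy≈1 =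
      - s , s * s - t , - (w * y) ,
      P₁-neg Ps , P₂-+ (P₁-* Ps Ps) (P₂-neg Pt) , (begin
      y
        ≈⟨ solve 4 (λ s t u y → y
             := ((𝟏 :+ dbl (s :+ dbl (t :+ dbl u))) :* y) :* polyz s t
                :- dbl (dbl (dbl (polyw s t u :* y)))) refl s t u y ⟩
      (1# + double (s + double (t + double u))) * y * z - double (double (double (w * y)))
        ≈⟨ +-congʳ (*-congʳ (trans (*-congʳ (sym x≈)) xy≈1)) ⟩
      1# * z - double (double (double (w * y)))
        ≈⟨ solve 3 (λ s t w → 𝟏 :* polyz s t :- dbl (dbl (dbl w))
             := 𝟏 :+ dbl ((:- s) :+ dbl (s :* s :- t :+ dbl (:- w)))) refl s t (w * y) ⟩
      1# + double (- s + double (s * s - t + double (- (w * y)))) ∎)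
      where
      polyz : ∀ {n} (s t : Polynomial n) → Polynomial n
      polyz s t = 𝟏 :+ dbl ((:- s) :+ dbl (s :* s :- t))
      polyw : ∀ {n} (s t u : Polynomial n) → Polynomial n
      polyw s t u = s :* s :* s :+ dbl (s :* s :* t :- s :* t :- t :* t) :+ u :* polyz s t
      z = 1# + double (- s + double (s * s - t))
      w = s * s * s + double (s * s * t - s * t - t * t) + u * z

open import Defs
open ≡ using (refl; cong; cong₂; sym; trans; subst)

-- Ring laws for the convolution of series.

module SeriesArithmetic where
  open ≡.≡-Reasoning

  infixl 6 _⊕_
  infixr 7 _·_

  _⊕_ : Series → Series → Series
  (a ⊕ b) n = a n ℤ.+ b n

  ⊝_ : Series → Series
  (⊝ a) n = ℤ.- a n

  𝟘 : Series
  𝟘 _ = 0ℤ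

  _·_ : ℤ → Series → Series
  (z · a) n = z ℤ.* a n

  tail : Series → Series
  tail a n = a (suc n)

  -- By computation `(a ⊛ b) (suc n)` splits at the head of `a`. This is the mirror split at the
  -- head of `b`, and the two together give commutativity by induction.
  ⊛-suc : ∀ a b n →
    (a ⊛ b) (suc n) ≡ a (suc n) ℤ.* b 0 ℤ.+ (a ⊛ tail b) n
  ⊛-suc a b zero    = lemma (a 0) (a 1) (b 0) (b 1)
    where
    lemma : ∀ a₀ a₁ b₀ b₁ →
      a₀ ℤ.* b₁ ℤ.+ (a₁ ℤ.* b₀ ℤ.+ 0ℤ) ≡ a₁ ℤ.* b₀ ℤ.+ (a₀ ℤ.* b₁ ℤ.+ 0ℤ)
    lemma = ℤSolver.solve-∀
  ⊛-suc a b (suc n) = begin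
    a 0 ℤ.* b (suc (suc n)) ℤ.+ (tail a ⊛ b) (suc n)
      ≡⟨ cong (ℤ._+_ (a 0 ℤ.* b (suc (suc n)))) (⊛-suc (tail a) b n) ⟩
    a 0 ℤ.* b (suc (suc n)) ℤ.+ (a (suc (suc n)) ℤ.* b 0 ℤ.+ (tail a ⊛ tail b) n)
      ≡⟨ lemma (a 0 ℤ.* b (suc (suc n))) (a (suc (suc n)) ℤ.* b 0) _ ⟩
    a (suc (suc n)) ℤ.* b 0 ℤ.+ (a ⊛ tail b) (suc n) ∎
    where
    lemma : ∀ x y z → x ℤ.+ (y ℤ.+ z) ≡ y ℤ.+ (x ℤ.+ z)
    lemma = ℤSolver.solve-∀

  ⊛-comm : ∀ a b → a ⊛ b ≗ b ⊛ a
  ⊛-comm a b zero    = cong (ℤ._+ 0ℤ) (ℤ.*-comm (a 0) (b 0))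
  ⊛-comm a b (suc n) = begin
    a 0 ℤ.* b (suc n) ℤ.+ (tail a ⊛ b) n
      ≡⟨ cong₂ ℤ._+_ (ℤ.*-comm (a 0) (b (suc n))) (⊛-comm (tail a) b n) ⟩
    b (suc n) ℤ.* a 0 ℤ.+ (b ⊛ tail a) n
      ≡⟨ ⊛-suc b a n ⟨
    (b ⊛ a) (suc n) ∎

  ⊛-zeroˡ : ∀ a → 𝟘 ⊛ a ≗ 𝟘
  ⊛-zeroˡ a n = sum-replicate-zero (suc n)

  ⊛-identityˡ : ∀ a → 𝟙 ⊛ a ≗ a
  ⊛-identityˡ a zero    = trans (ℤ.+-identityʳ _) (ℤ.*-identityˡ (a 0))
  ⊛-identityˡ a (suc n) = trans
    (cong₂ ℤ._+_ (ℤ.*-identityˡ (a (suc n))) (⊛-zeroˡ a n)) (ℤ.+-identityʳ _)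

  ⊛-distribʳ-⊕ : ∀ c a b → (a ⊕ b) ⊛ c ≗ (a ⊛ c) ⊕ (b ⊛ c)
  ⊛-distribʳ-⊕ c a b zero    = lemma (a 0) (b 0) (c 0)
    where
    lemma : ∀ x y z →
      (x ℤ.+ y) ℤ.* z ℤ.+ 0ℤ ≡ x ℤ.* z ℤ.+ 0ℤ ℤ.+ (y ℤ.* z ℤ.+ 0ℤ)
    lemma = ℤSolver.solve-∀
  ⊛-distribʳ-⊕ c a b (suc n) = trans
    (cong (ℤ._+_ ((a 0 ℤ.+ b 0) ℤ.* c (suc n))) (⊛-distribʳ-⊕ c (tail a) (tail b) n))
    (lemma (a 0) (b 0) (c (suc n)) _ _)
    where
    lemma : ∀ x y z v w →
      (x ℤ.+ y) ℤ.* z ℤ.+ (v ℤ.+ w) ≡ x ℤ.* z ℤ.+ v ℤ.+ (y ℤ.* z ℤ.+ w)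
    lemma = ℤSolver.solve-∀

  ·-⊛-assoc : ∀ z a b → (z · a) ⊛ b ≗ z · (a ⊛ b)
  ·-⊛-assoc z a b zero    = lemma z (a 0) (b 0)
    where
    lemma : ∀ x y z → x ℤ.* y ℤ.* z ℤ.+ 0ℤ ≡ x ℤ.* (y ℤ.* z ℤ.+ 0ℤ)
    lemma = ℤSolver.solve-∀
  ·-⊛-assoc z a b (suc n) = trans
    (cong (ℤ._+_ (z ℤ.* a 0 ℤ.* b (suc n))) (·-⊛-assoc z (tail a) b n))
    (lemma z (a 0) (b (suc n)) _)
    where
    lemma : ∀ x y z w → x ℤ.* y ℤ.* z ℤ.+ x ℤ.* w ≡ x ℤ.* (y ℤ.* z ℤ.+ w)
    lemma = ℤSolver.solve-∀

  ⊛-assoc : ∀ a b c → (a ⊛ b) ⊛ c ≗ a ⊛ (b ⊛ c)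
  ⊛-assoc a b c zero    = lemma (a 0) (b 0) (c 0)
    where
    lemma : ∀ x y z →
      (x ℤ.* y ℤ.+ 0ℤ) ℤ.* z ℤ.+ 0ℤ ≡ x ℤ.* (y ℤ.* z ℤ.+ 0ℤ) ℤ.+ 0ℤ
    lemma = ℤSolver.solve-∀
  ⊛-assoc a b c (suc n) = begin
    -- The tail of `a ⊛ b` computes to `(a 0 · tail b) ⊕ (tail a ⊛ b)`.
    (a 0 ℤ.* b 0 ℤ.+ 0ℤ) ℤ.* c (suc n) ℤ.+ (((a 0 · tail b) ⊕ (tail a ⊛ b)) ⊛ c) n
      ≡⟨ cong (ℤ._+_ ((a 0 ℤ.* b 0 ℤ.+ 0ℤ) ℤ.* c (suc n))) (trans (⊛-distribʳ-⊕ c (a 0 · tail b) (tail a ⊛ b) n)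
           (cong₂ ℤ._+_ (·-⊛-assoc (a 0) (tail b) c n) (⊛-assoc (tail a) b c n))) ⟩
    (a 0 ℤ.* b 0 ℤ.+ 0ℤ) ℤ.* c (suc n)
      ℤ.+ (a 0 ℤ.* (tail b ⊛ c) n ℤ.+ (tail a ⊛ (b ⊛ c)) n)
      ≡⟨ lemma (a 0) (b 0) (c (suc n)) _ _ ⟩
    (a ⊛ (b ⊛ c)) (suc n) ∎
    where
    lemma : ∀ x y z v w →
      (x ℤ.* y ℤ.+ 0ℤ) ℤ.* z ℤ.+ (x ℤ.* v ℤ.+ w) ≡ x ℤ.* (y ℤ.* z ℤ.+ v) ℤ.+ w
    lemma = ℤSolver.solve-∀

  q^-+ : ∀ d e → q^ (d ℕ.+ e) ≗ q^ d ⊛ q^ e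
  q^-+ zero    e n       = sym (⊛-identityˡ (q^ e) n)
  q^-+ (suc d) e zero    = refl
  q^-+ (suc d) e (suc n) = trans (q^-+ d e n) (sym (ℤ.+-identityˡ _))

open SeriesArithmetic

-- ℤ[[q]]/(q^(N+1)), so that infinite products become finite ones.
module Truncation (N : ℕ) where

  infix 4 _≈_

  _≈_ : Series → Series → Set
  a ≈ b = ∀ m → m ℕ.≤ N → a m ≡ b m

  ≗⇒≈ : ∀ {a b} → a ≗ b → a ≈ b
  ≗⇒≈ a≗b m _ = a≗b m

  -- Coefficient m of a product involves only coefficients of index at most m.
  ⊛-cong : ∀ {a a′ b b′} → a ≈ a′ → b ≈ b′ → a ⊛ b ≈ a′ ⊛ b′
  ⊛-cong a≈a′ b≈b′ m m≤N = sum-cong-≗ λ j → cong₂ ℤ._*_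
    (a≈a′ (toℕ j) (ℕ.≤-trans (toℕ≤pred[n] j) m≤N))
    (b≈b′ (m ℕ.∸ toℕ j) (ℕ.≤-trans (ℕ.m∸n≤m m (toℕ j)) m≤N))

  ring : CommutativeRing 0ℓ 0ℓ
  ring = record
    { Carrier = Series
    ; _≈_ = _≈_
    ; _+_ = _⊕_
    ; _*_ = _⊛_
    ; -_  = ⊝_
    ; 0#  = 𝟘
    ; 1#  = 𝟙
    ; isCommutativeRing = record
      { isRing = record
        { +-isAbelianGroup = record
          { isGroup = record
            { isMonoid = record
              { isSemigroup = record
                { isMagma = record
                  { isEquivalence = record
                    { refl  = λ _ _ → refl
                    ; sym   = λ p m m≤N → sym (p m m≤N)
                    ; trans = λ p q m m≤N → trans (p m m≤N) (q m m≤N)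
                    }
                  ; ∙-cong = λ p q m m≤N → cong₂ ℤ._+_ (p m m≤N) (q m m≤N)
                  }
                ; assoc = λ a b c m _ → ℤ.+-assoc (a m) (b m) (c m)
                }
              ; identity = (λ a m _ → ℤ.+-identityˡ (a m)) , (λ a m _ → ℤ.+-identityʳ (a m))
              }
            ; inverse = (λ a m _ → ℤ.+-inverseˡ (a m)) , (λ a m _ → ℤ.+-inverseʳ (a m))
            ; ⁻¹-cong = λ p m m≤N → cong (λ z → ℤ.- z) (p m m≤N)
            }
          ; comm = λ a b m _ → ℤ.+-comm (a m) (b m)
          }
        ; *-cong = ⊛-cong
        ; *-assoc = λ a b c → ≗⇒≈ (⊛-assoc a b c)
        ; *-identity = (λ a → ≗⇒≈ (⊛-identityˡ a))
            , (λ a → ≗⇒≈ λ m → trans (⊛-comm a 𝟙 m) (⊛-identityˡ a m))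
        ; distrib = (λ c a b → ≗⇒≈ λ m → trans (⊛-comm c (a ⊕ b) m)
              (trans (⊛-distribʳ-⊕ c a b m) (cong₂ ℤ._+_ (⊛-comm a c m) (⊛-comm b c m))))
            , (λ c a b → ≗⇒≈ (⊛-distribʳ-⊕ c a b))
        }
      ; *-comm = λ a b → ≗⇒≈ (⊛-comm a b)
      }
    }

-- Supports of series under the ring operations.

SupportedOn : (ℕ → Set) → Series → Set
SupportedOn A a = ∀ m → a m ≡ 0ℤ ⊎ A m

module Support where

  supported-𝟘 : ∀ {A} → SupportedOn A 𝟘
  supported-𝟘 m = inj₁ refl

  supported-⊕ : ∀ {A a b} → SupportedOn A a → SupportedOn A b → SupportedOn A (a ⊕ b)
  supported-⊕ sa sb m with sa m | sb m
  ... | inj₂ Am    | _          = inj₂ Am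
  ... | inj₁ _     | inj₂ Am    = inj₂ Am
  ... | inj₁ am≡0  | inj₁ bm≡0  = inj₁ (cong₂ ℤ._+_ am≡0 bm≡0)

  supported-⊝ : ∀ {A a} → SupportedOn A a → SupportedOn A (⊝ a)
  supported-⊝ sa m = Sum.map₁ (cong (λ z → ℤ.- z)) (sa m)

  sum-zero : ∀ {P : Set} {n} (t : Fin n → ℤ) → (∀ j → t j ≡ 0ℤ ⊎ P) → sum t ≡ 0ℤ ⊎ P
  sum-zero {n = zero}  t z = inj₁ refl
  sum-zero {n = suc n} t z with z zero | sum-zero (t ∘ suc) (z ∘ suc)
  ... | inj₂ p    | _        = inj₂ p
  ... | inj₁ _    | inj₂ p   = inj₂ p
  ... | inj₁ t₀≡0 | inj₁ s≡0 = inj₁ (cong₂ ℤ._+_ t₀≡0 s≡0)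

  supported-⊛ : ∀ {A B C : ℕ → Set} {a b} → (∀ {i j} → A i → B j → C (i ℕ.+ j)) →
    SupportedOn A a → SupportedOn B b → SupportedOn C (a ⊛ b)
  supported-⊛ {C = C} {a} {b} A+B⊆C sa sb m = sum-zero _ term
    where
    term : ∀ j → a (toℕ j) ℤ.* b (m ℕ.∸ toℕ j) ≡ 0ℤ ⊎ C m
    term j with sa (toℕ j) | sb (m ℕ.∸ toℕ j)
    ... | inj₁ a≡0 | _        = inj₁ (cong (ℤ._* b (m ℕ.∸ toℕ j)) a≡0)
    ... | inj₂ _   | inj₁ b≡0 =
      inj₁ (trans (cong (a (toℕ j) ℤ.*_) b≡0) (ℤ.*-zeroʳ (a (toℕ j))))
    ... | inj₂ Aj  | inj₂ Bk  =
      inj₂ (subst C (ℕ.m+[n∸m]≡n (toℕ≤pred[n] j)) (A+B⊆C Aj Bk))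

  supported-weaken : ∀ {A B : ℕ → Set} {a} → (∀ {m} → A m → B m) →
    SupportedOn A a → SupportedOn B a
  supported-weaken A⊆B sa m = Sum.map₂ A⊆B (sa m)

  q^-supported : ∀ e → SupportedOn (_≡ e) (q^ e)
  q^-supported zero    zero    = inj₂ refl
  q^-supported zero    (suc m) = inj₁ refl
  q^-supported (suc e) zero    = inj₁ refl
  q^-supported (suc e) (suc m) = Sum.map₂ (cong suc) (q^-supported e m)

  module _ (N : ℕ) where
    open import Algebra.Properties.Semiring.Exp
      (CommutativeRing.semiring (Truncation.ring N)) using () renaming (_^_ to _^ᴿ_)

    -- Stated for any monomial, so that it covers the negated powers of q in the theta terms.
    power-supported : ∀ {a e} → SupportedOn (_≡ e) a →
      ∀ n → SupportedOn (_≡ n ℕ.* e) (a ^ᴿ n)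
    power-supported sa zero    = q^-supported 0
    power-supported sa (suc n) =
      supported-⊛ (cong₂ ℕ._+_) sa (power-supported sa n)

open Support

-- Squares and doubled squares modulo 8.

module Residues where

  -- The residues modulo 8 of the numbers x² and 2x².
  residues : List ℕ
  residues = 0 ∷ 1 ∷ 2 ∷ 4 ∷ []

  Residue : ℕ → Set
  Residue m = m % 8 ∈ residues

  Residue-+ : ∀ i j → Residue i → Residue j → (i ℕ.+ j) % 8 ≢ 7
  Residue-+ i j ri rj i+j≡7 =
    All.lookup (All.lookup table ri) rj (trans (sym (%-distribˡ-+ i j 8)) i+j≡7)
    where
    table : All (λ r → All (λ s → (r ℕ.+ s) % 8 ≢ 7) residues) residues
    table = from-yes (All.all? (λ r →
      All.all? (λ s → ¬? ((r ℕ.+ s) % 8 ℕ.≟ 7)) residues) residues)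

  -- Only k modulo 8 matters, so a table over `Fin 8` decides it. The bracketing is that of the
  -- exponent which `power-supported` yields for the k-th theta term.
  Residue-k*[k*j] : ∀ j → (∀ (r : Fin 8) → Residue (toℕ r ℕ.* (toℕ r ℕ.* j))) →
    ∀ k → Residue (k ℕ.* (k ℕ.* j))
  Residue-k*[k*j] j table k =
    subst (_∈ residues) (sym reduce)
      (subst (λ r → Residue (r ℕ.* (r ℕ.* j))) (Fin.toℕ-fromℕ< (m%n<n k 8))
        (table (fromℕ< (m%n<n k 8))))
    where
    open ≡.≡-Reasoning
    r = k % 8
    inner : (k ℕ.* j) % 8 ≡ (r ℕ.* j) % 8
    inner = begin
      (k ℕ.* j) % 8              ≡⟨ %-distribˡ-* k j 8 ⟩
      (r ℕ.* (j % 8)) % 8        ≡⟨ cong (λ s → (s ℕ.* (j % 8)) % 8) (m%n%n≡m%n k 8) ⟨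
      (r % 8 ℕ.* (j % 8)) % 8    ≡⟨ %-distribˡ-* r j 8 ⟨
      (r ℕ.* j) % 8              ∎
    reduce : (k ℕ.* (k ℕ.* j)) % 8 ≡ (r ℕ.* (r ℕ.* j)) % 8
    reduce = begin
      (k ℕ.* (k ℕ.* j)) % 8                    ≡⟨ %-distribˡ-* k (k ℕ.* j) 8 ⟩
      (r ℕ.* ((k ℕ.* j) % 8)) % 8
        ≡⟨ cong₂ (λ s t → (s ℕ.* t) % 8) (m%n%n≡m%n k 8) (sym inner) ⟨
      (r % 8 ℕ.* ((r ℕ.* j) % 8)) % 8          ≡⟨ %-distribˡ-* r (r ℕ.* j) 8 ⟨
      (r ℕ.* (r ℕ.* j)) % 8                    ∎

  Residue-square : ∀ k → Residue (k ℕ.* (k ℕ.* 1))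
  Residue-square = Residue-k*[k*j] 1
    (from-yes (Fin.all? λ (r : Fin 8) → (toℕ r ℕ.* (toℕ r ℕ.* 1)) % 8 ∈? residues))

  Residue-twice-square : ∀ k → Residue (k ℕ.* (k ℕ.* 2))
  Residue-twice-square = Residue-k*[k*j] 2
    (from-yes (Fin.all? λ (r : Fin 8) → (toℕ r ℕ.* (toℕ r ℕ.* 2)) % 8 ∈? residues))

  ¬Residue⇒≢0 : ∀ m → ¬ Residue m → m % 8 ≢ 0
  ¬Residue⇒≢0 m ¬Rm m≡0 = ¬Rm (subst (_∈ residues) (sym m≡0) (from-yes (0 ∈? residues)))

  ¬Residue-≡ : ∀ m {r} → m % 8 ≡ r → ¬ r ∈ residues → ¬ Residue m
  ¬Residue-≡ m refl r∉ = r∉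

  -- Reduction modulo 4 factors through reduction modulo 8, and none of 0, 1, 2, 4 is 3 modulo 4.
  ≡3[4]⇒¬Residue : ∀ m → m % 4 ≡ 3 → ¬ Residue m
  ≡3[4]⇒¬Residue m m≡3 Rm = All.lookup
    (from-yes (All.all? (λ r → ¬? (r % 4 ℕ.≟ 3)) residues)) Rm
    (trans (m∣n⇒o%n%m≡o%m 4 8 m (ℕ.divides 2 refl)) m≡3)

open Residues

-- The overcubic series modulo q^(N+1), and divisibility of its coefficient of index N.

module Overcubic (N : ℕ) where
  open Truncation N
  open CommutativeRing ring using (reflexive) renaming
    (refl to ≈-refl; sym to ≈-sym; trans to ≈-trans)
  open import Algebra.Properties.Semiring.Exp (CommutativeRing.semiring ring)
    using () renaming (_^_ to _^ᴿ_)
  open EtaQuotients ring using (U; S; θ; Gauss; eta-quotient-reciprocal)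
  open DyadicExpansions.Closure ring (SupportedOn Residue) (SupportedOn (λ m → m % 8 ≢ 7))
    supported-𝟘 supported-⊕ supported-⊝ supported-𝟘 supported-⊕ supported-⊝
    (supported-⊛ (λ {i} {j} → Residue-+ i j))

  q^-* : ∀ k n → q^ (k ℕ.* n) ≈ (q^ k) ^ᴿ n
  q^-* k zero    rewrite ℕ.*-zeroʳ k = λ _ _ → refl
  q^-* k (suc n) rewrite ℕ.*-suc k n = λ m m≤N →
    trans (q^-+ k (k ℕ.* n) m) (⊛-cong {a = q^ k} (λ _ _ → refl) (q^-* k n) m m≤N)

  ∏≤≈U : ∀ k n → ∏≤ n (λ n → 𝟙 ⊖ q^ (k ℕ.* n)) ≈ U (q^ k) n
  ∏≤≈U k zero    = λ _ _ → refl
  ∏≤≈U k (suc n) = ⊛-cong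
    (λ m m≤N → cong (λ z → 𝟙 m ℤ.- z) (q^-* k (suc n) m m≤N)) (∏≤≈U k n)

  -- By stability the same N factors compute every coefficient up to index N.
  f≈U : ∀ k .{{_ : ℕ.NonZero k}} → f k ≈ U (q^ k) N
  f≈U k m m≤N = trans (sym (f-stable k m≤N)) (∏≤≈U k N m m≤N)

  -- Gauss's identity at q^k: since k ≥ 1, q^(k(N+1)) vanishes in the truncated ring.
  f²≈fθ : ∀ k .{{_ : ℕ.NonZero k}} .{{_ : ℕ.NonZero (k ℕ.+ k)}} →
    f k ⊛ f k ≈ f (k ℕ.+ k) ⊛ θ (q^ k) N
  f²≈fθ k = ≈-trans (⊛-cong (f≈U k) (f≈U k))
    (≈-trans (Gauss (q^ k) (q^ (k ℕ.+ k)) N q^ᴺ⁺¹≈0 (≗⇒≈ (q^-+ k k)))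
      (⊛-cong (≈-sym (f≈U (k ℕ.+ k))) (≈-refl {θ (q^ k) N})))
    where
    q^ᴺ⁺¹≈0 : (q^ k) ^ᴿ suc N ≈ 𝟘
    q^ᴺ⁺¹≈0 m m≤N = trans (sym (q^-* k (suc N) m m≤N))
      (q^-below (ℕ.<-≤-trans (ℕ.s≤s m≤N) (ℕ.m≤n*m (suc N) k)))

  S-supported : ∀ j → (∀ k → Residue (k ℕ.* (k ℕ.* j))) →
    ∀ n → SupportedOn Residue (S (q^ j) n)
  S-supported j sq zero    = supported-𝟘
  S-supported j sq (suc n) = supported-⊕ (S-supported j sq n)
    (supported-weaken (λ { refl → sq (suc n) })
      (power-supported N (supported-⊝ (power-supported N (q^-supported j) (suc n))) (suc n)))

  denominator : ℕ → Series
  denominator k = f 1 ^ 2 ⊛ f 2 ^ suc (k ℕ.+ k)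

  denominator-constant : ∀ k → denominator k 0 ≡ 1ℤ
  denominator-constant k = begin
    1ℤ ℤ.* (f 2 ^ suc (k ℕ.+ k)) 0 ℤ.+ 0ℤ ≡⟨ ⊛-identityˡ (f 2 ^ suc (k ℕ.+ k)) 0 ⟩
    (f 2 ^ suc (k ℕ.+ k)) 0               ≡⟨ power (suc (k ℕ.+ k)) ⟩
    1ℤ                                    ∎
    where
    open ≡.≡-Reasoning
    power : ∀ e → (f 2 ^ e) 0 ≡ 1ℤ
    power zero    = refl
    power (suc e) = trans (⊛-identityˡ (f 2 ^ e) 0) (power e)

  -- Once 2c is written as 3 + (2k + 1), the integer exponent computes to a natural number and
  -- `_^ᶻ_` takes its nonnegative branch.
  ā≡ : ∀ k → ā (suc (suc k)) ≡ f 4 ^ suc k ⊛ denominator k ⁻¹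
  ā≡ k = cong (λ e → f 4 ^ suc k ⊛ (f 1 ^ 2 ⊛ f 2 ^ᶻ e) ⁻¹)
    (cong (λ n → + n ℤ.- + 3) (lemma k))
    where
    lemma : ∀ k → 2 ℕ.* suc (suc k) ≡ 3 ℕ.+ suc (k ℕ.+ k)
    lemma = ℕSolver.solve-∀

  ^≈^ᴿ : ∀ a n → a ^ n ≈ a ^ᴿ n
  ^≈^ᴿ a zero    = ≈-refl {𝟙}
  ^≈^ᴿ a (suc n) = ⊛-cong (≈-refl {a}) (^≈^ᴿ a n)

  denominator⁻¹-inverse : ∀ k → (f 1 ^ᴿ 2 ⊛ f 2 ^ᴿ suc (k ℕ.+ k)) ⊛ denominator k ⁻¹ ≈ 𝟙
  denominator⁻¹-inverse k = ≈-trans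
    (⊛-cong (⊛-cong (≈-refl {f 1 ^ 2}) (≈-sym (^≈^ᴿ (f 2) (suc (k ℕ.+ k)))))
      (≈-refl {denominator k ⁻¹}))
    (≗⇒≈ (⊛-inverseʳ (denominator k) (denominator-constant k)))

  ā≈ : ∀ k → ā (suc (suc k)) ≈ f 4 ^ᴿ suc k ⊛ denominator k ⁻¹
  ā≈ k = ≈-trans (reflexive (ā≡ k))
    (⊛-cong (^≈^ᴿ (f 4) (suc k)) (≈-refl {denominator k ⁻¹}))

  θθā≈1 : ∀ k → (θ (q^ 1) N ⊛ θ (q^ 2) N ^ᴿ suc k) ⊛ ā (suc (suc k)) ≈ 𝟙
  θθā≈1 k = ≈-trans
    (⊛-cong (≈-refl {θ (q^ 1) N ⊛ θ (q^ 2) N ^ᴿ suc k}) (ā≈ k))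
    (eta-quotient-reciprocal {f 1} {f 2} {f 4} {f 4 ⁻¹} {denominator k ⁻¹}
      {θ (q^ 1) N} {θ (q^ 2) N} k (f²≈fθ 1) (f²≈fθ 2)
      (≗⇒≈ (⊛-inverseʳ (f 4) refl)) (denominator⁻¹-inverse k))

  𝟙-vanishes : N % 8 ≢ 0 → 𝟙 N ≡ 0ℤ
  𝟙-vanishes N≢0 = case q^-supported 0 N of λ where
    (inj₁ 𝟙N≡0) → 𝟙N≡0
    (inj₂ N≡0)  → contradiction (cong (_% 8) N≡0) N≢0

  -- At an index N off the residues, 1 and 2s contribute nothing, which leaves 4t + 8u. The
  -- alternative on t is kept for the case N ≡ 7 modulo 8.
  coefficient-off-residues : ∀ {x} → Expansion x → ¬ Residue N →
    ∃[ t ] ∃[ u ] (t ≡ 0ℤ ⊎ N % 8 ≢ 7) × x N ≡ (t ℤ.+ u ℤ.* + 2) ℤ.* + 4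
  coefficient-off-residues (s , t , u , s-supp , t-supp , x≈) ¬RN =
    t N , u N , t-supp N , trans (x≈ N ℕ.≤-refl) (trans
      (cong₂ (λ x y → x ℤ.+ (y ℤ.+ w ℤ.+ (y ℤ.+ w))) (𝟙-vanishes (¬Residue⇒≢0 N ¬RN)) sN≡0)
      (lemma (t N) (u N)))
    where
    sN≡0 : s N ≡ 0ℤ
    sN≡0 = Sum.[ (λ sN≡0 → sN≡0) , (λ RN → contradiction RN ¬RN) ]′ (s-supp N)
    w = t N ℤ.+ (u N ℤ.+ u N) ℤ.+ (t N ℤ.+ (u N ℤ.+ u N))
    lemma : ∀ t u → let w = t ℤ.+ (u ℤ.+ u) ℤ.+ (t ℤ.+ (u ℤ.+ u)) in
      0ℤ ℤ.+ (0ℤ ℤ.+ w ℤ.+ (0ℤ ℤ.+ w)) ≡ (t ℤ.+ u ℤ.* + 2) ℤ.* + 4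
    lemma = ℤSolver.solve-∀

  4∣coefficient : ∀ {x} → Expansion x → ¬ Residue N → + 4 ∣ x N
  4∣coefficient Ex ¬RN with t , u , _ , eq ← coefficient-off-residues Ex ¬RN =
    divides (t ℤ.+ u ℤ.* + 2) eq

  8∣coefficient : ∀ {x} → Expansion x → N % 8 ≡ 7 → + 8 ∣ x N
  8∣coefficient Ex N≡7
    with coefficient-off-residues Ex (¬Residue-≡ N N≡7 (from-yes (¬? (7 ∈? residues))))
  ... | t , u , inj₂ N≢7  , _  = contradiction N≡7 N≢7
  ... | t , u , inj₁ refl , eq = divides u (trans eq (lemma u))
    where
    lemma : ∀ u → (0ℤ ℤ.+ u ℤ.* + 2) ℤ.* + 4 ≡ u ℤ.* + 8
    lemma = ℤSolver.solve-∀

  ā-expansion : ∀ k → Expansion (ā (suc (suc k)))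
  ā-expansion k = expansion-inverse {θ₁ ⊛ θ₂ ^ᴿ suc k} {ā (suc (suc k))}
    (expansion-* {θ₁} {θ₂ ^ᴿ suc k}
      (expansion-1+2s {S (q^ 1) N} (S-supported 1 Residue-square N))
      (expansion-^ {θ₂}
        (expansion-1+2s {S (q^ 2) N} (S-supported 2 Residue-twice-square N)) (suc k)))
    (θθā≈1 k)
    where
    θ₁ = θ (q^ 1) N
    θ₂ = θ (q^ 2) N

  4∣ā : ¬ Residue N → ∀ k → + 4 ∣ ā (suc (suc k)) N
  4∣ā ¬RN k = 4∣coefficient {ā (suc (suc k))} (ā-expansion k) ¬RN

  8∣ā : N % 8 ≡ 7 → ∀ k → + 8 ∣ ā (suc (suc k)) N
  8∣ā N≡7 k = 8∣coefficient {ā (suc (suc k))} (ā-expansion k) N≡7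

-- Passage to the four arithmetic progressions.

open import Data.Nat.Base using (ℕ; _+_; _*_; _≤_)

theorem1p5 : ∀ (n i : ℕ) → 1 ≤ i →
    (+ 4 ∣ ā (2 * i) (4 * n + 3)) ×
    (+ 4 ∣ ā (2 * i) (8 * n + 6)) ×
    (+ 4 ∣ ā (2 * i) (8 * n + 5)) ×
    (+ 8 ∣ ā (2 * i) (8 * n + 7))
-- From i ≥ 1 comes 2i = 2 + k, the form `suc (suc k)` of the index used above.
theorem1p5 n i 1≤i with k , 2+k≡2i ← ℕ.m≤n⇒∃[o]m+o≡n (ℕ.*-monoʳ-≤ 2 1≤i) =
  subst
    (λ c → (+ 4 ∣ ā c (4 * n + 3)) × (+ 4 ∣ ā c (8 * n + 6)) ×
           (+ 4 ∣ ā c (8 * n + 5)) × (+ 8 ∣ ā c (8 * n + 7)))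
    2+k≡2i
    ( Overcubic.4∣ā (4 * n + 3) (≡3[4]⇒¬Residue (4 * n + 3) ([kn+r]%k≡r 4 n 3)) k
    , Overcubic.4∣ā (8 * n + 6)
        (¬Residue-≡ (8 * n + 6) ([kn+r]%k≡r 8 n 6) (from-yes (¬? (6 ∈? residues)))) k
    , Overcubic.4∣ā (8 * n + 5)
        (¬Residue-≡ (8 * n + 5) ([kn+r]%k≡r 8 n 5) (from-yes (¬? (5 ∈? residues)))) k
    , Overcubic.8∣ā (8 * n + 7) ([kn+r]%k≡r 8 n 7) k
    )
  where
  [kn+r]%k≡r : ∀ k .{{_ : ℕ.NonZero k}} n r → (k * n + r) % k ≡ r % k
  [kn+r]%k≡r k n r =
    trans (cong (_% k) (trans (ℕ.+-comm (k * n) r) (cong (r ℕ.+_) (ℕ.*-comm k n))))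
      ([m+kn]%n≡m%n r n k)
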